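{- Let $w\in S_n$ be $k$-Grassmannian with $x_w\ne e$ (i.e. $x_w\neq\Lambda^k$ as an affine permutation). Then the right descent set of $x_w$ is exactly $\{s_0\}$. In particular $x_w$ lies in $(\tilde S_n^{(k)})^J$, i.e. $x_w$ is the unique element of minimal length in the coset $x_wW_J$.
   Context: Let $n\ge2$, $0\le k\le n$. $\tilde S_n$ is the group of bijections $f:\mathbb{Z}\to\mathbb{Z}$ with $f(i+n)=f(i)+n$, with products read left to right, $(fg)(a)=g(f(a))$. $\tilde S_n^{(k)}$ is the subset with $\frac1n\sum_{i=1}^n(f(i)-i)=k$. Length: $\ell(f)=\#\{(a,b):1\le a\le n,\ b\in\mathbb{Z},\ a<b,\ f(a)>f(b)\}$. $s_i$ ($0\le i\le n-1$) exchanges $i+mn$ and $i+1+mn$ for all $m$ and fixes all other integers. $\Lambda(i)=i+1$. Elements of $\tilde S_n^{(k)}$ are identified with elements of the affine Weyl group $\tilde S_n^{(0)}$ by $f\mapsto\Lambda^{ -k}f$; under this identification "$x_w=e$" means $\Lambda^{ -k}x_w=e$. The right descent set of $x$ is $\{s_i:\ell(xs_i)<\ell(x)\}$. $J=\{s_1,\dots,s_{n-1}\}$, $W_J=\langle J\rangle\cong S_n$, and $(\tilde S_n^{(k)})^J=\{x\in\tilde S_n^{(k)}:\ell(xs)>\ell(x)\ \forall s\in J\}$. A permutation $w\in S_n$ is $k$-Grassmannian if $w(1)<\dots<w(k)$ and $w(k+1)<\dots<w(n)$. $\tau_{k,n}\in\tilde S_n^{(k)}$ is given by $\tau_{k,n}(i)=i+n$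 for $1\le i\le k$ and $\tau_{k,n}(i)=i$ for $k+1\le i\le n$; and $x_w:=w^{ -1}\tau_{k,n}$, where $S_n\subset\tilde S_n$ via periodic extension. -}

module Defs where

open import Algebra.Bundles using (Group)
import Algebra.Definitions.RawMonoid as RawMonoidDefs
open import Data.Bool.Base using (if_then_else_)
open import Data.Empty using (⊥-elim)
open import Data.Fin.Base as Fin using (Fin; toℕ; fromℕ<)
open import Data.Fin.Permutation using (Permutation′; _⟨$⟩ʳ_; _⟨$⟩ˡ_; inverseˡ; inverseʳ)
open import Data.Fin.Properties using (toℕ-injective; toℕ-fromℕ<; toℕ<n)
open import Data.Integer.Base using (ℤ; +_; -[1+_]; _+_; _-_; -_; _*_; _≤_; _<_; ∣_∣; 0ℤ; 1ℤ; +≤+; -≤+; +<+)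
open import Data.Integer.DivMod using (_/ℕ_; _%ℕ_; n%ℕd<d; a≡a%ℕn+[a/ℕn]*n)
open import Data.Integer.Divisibility.Signed using (_∣_; _∣?_; ∣-refl; ∣m∣n⇒∣m+n; ∣m+n∣n⇒∣m; ∣m∣n⇒∣m-n; ∣⇒∣ᵤ)
import Data.Integer.Properties as ℤ
open import Data.Integer.Tactic.RingSolver using (solve-∀)
open import Data.List.Base using (List; _∷_; map; foldr; upTo; length; filter; cartesianProduct; lookup)
open import Data.List.Membership.Propositional using () renaming (_∈_ to _∈ˡ_)
open import Data.List.Membership.Propositional.Properties using (∈-map⁺; ∈-upTo⁺; ∈-filter⁺; ∈-filter⁻; ∈-lookup; ∈-cartesianProduct⁺)
open import Data.List.Relation.Unary.All as All using ()
open import Data.List.Relation.Unary.AllPairs using (_∷_)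
open import Data.List.Relation.Unary.Any using (here; there; index)
open import Data.List.Relation.Unary.Any.Properties using (lookup-index)
open import Data.List.Relation.Unary.Unique.Propositional using (Unique)
import Data.List.Relation.Unary.Unique.Propositional.Properties as Unique
open import Data.Nat.ListAction using (sum)
open import Data.Nat.Base as ℕ using (ℕ; NonZero; NonTrivial; nonTrivial⇒nonZero; nonTrivial⇒≢1)
import Data.Nat.Divisibility as ℕ
import Data.Nat.Properties as ℕ
open import Data.Product.Base using (∃; Σ; _×_; _,_; proj₁; proj₂)
open import Data.Product.Properties using (Σ-≡,≡→≡)
open import Data.Rational.Base as ℚ using ()
open import Function.Base using (_∘_)
open import Function.Bundles using (_↔_; Inverse; mk↔ₛ′)
open import Function.Construct.Composition using () renaming (inverse to _⨾_)
open import Function.Construct.Identity using () renaming (↔-id to ↔-refl)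
open import Function.Construct.Symmetry using () renaming (↔-sym to flip↔)
open import Level using (0ℓ)
open import Relation.Binary.PropositionalEquality using (_≡_; refl; sym; trans; cong; cong₂; subst; module ≡-Reasoning)
open import Relation.Nullary.Decidable using (Dec; yes; no; does; _×-dec_; dec-true; dec-false)
open import Relation.Nullary.Negation using (¬_)
open import Relation.Unary using (Pred; _∈_)

record S̃ (n : ℕ) : Set where
  field
    perm     : ℤ ↔ ℤ
    periodic : ∀ i → Inverse.to perm (i + + n) ≡ Inverse.to perm i + + n

open S̃ public

infixl 10 _⟨$⟩_
_⟨$⟩_ : ∀ {n} → S̃ n → ℤ → ℤ
f ⟨$⟩ a = Inverse.to (perm f) a

infix 4 _≈_
_≈_ : ∀ {n} → S̃ n → S̃ n → Set
f ≈ g = ∀ a → f ⟨$⟩ a ≡ g ⟨$⟩ a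

e : ∀ {n} → S̃ n
e = record { perm = ↔-refl ℤ ; periodic = λ _ → refl }

-- Products are read left to right: (f ∙ g) ⟨$⟩ a  is  g ⟨$⟩ (f ⟨$⟩ a).
infixl 7 _∙_
_∙_ : ∀ {n} → S̃ n → S̃ n → S̃ n
f ∙ g = record
  { perm     = perm f ⨾ perm g
  ; periodic = λ i → trans (cong (g ⟨$⟩_) (periodic f i)) (periodic g (f ⟨$⟩ i))
  }

infix 8 _⁻¹
_⁻¹ : ∀ {n} → S̃ n → S̃ n
_⁻¹ {n} f = record { perm = flip↔ (perm f) ; periodic = per }
  where
  open Inverse (perm f)
  per : ∀ i → from (i + + n) ≡ from i + + n
  per i = begin
    from (i + + n)                ≡⟨ cong (λ j → from (j + + n)) (strictlyInverseˡ i) ⟨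
    from (to (from i) + + n)      ≡⟨ cong from (periodic f (from i)) ⟨
    from (to (from i + + n))      ≡⟨ strictlyInverseʳ (from i + + n) ⟩
    from i + + n                  ∎
    where open ≡-Reasoning

S̃-group : ℕ → Group 0ℓ 0ℓ
S̃-group n = record
  { Carrier = S̃ n
  ; _≈_     = _≈_
  ; _∙_     = _∙_
  ; ε       = e
  ; _⁻¹     = _⁻¹
  ; isGroup = record
    { isMonoid = record
      { isSemigroup = record
        { isMagma = record
          { isEquivalence = record
            { refl  = λ _ → refl
            ; sym   = λ p a → sym (p a)
            ; trans = λ p q a → trans (p a) (q a)
            }
          ; ∙-cong = λ {_} {_} {g} {g′} p q a → trans (cong (g ⟨$⟩_) (p a)) (q _)
          }
        ; assoc = λ _ _ _ _ → refl
        }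
      ; identity = (λ _ _ → refl) , (λ _ _ → refl)
      }
    ; inverse = (λ f → Inverse.strictlyInverseˡ (perm f)) , (λ f → Inverse.strictlyInverseʳ (perm f))
    ; ⁻¹-cong = λ {f} {g} p a →
        trans (sym (Inverse.strictlyInverseʳ (perm g) _))
              (cong (Inverse.from (perm g))
                (trans (sym (p _)) (Inverse.strictlyInverseˡ (perm f) a)))
    }
  }

infixl 9 _^_
_^_ : ∀ {n} → S̃ n → ℕ → S̃ n
_^_ {n} f m = m ×ᴹ f
  where open RawMonoidDefs (Group.rawMonoid (S̃-group n)) renaming (_×_ to _×ᴹ_)

Λ : ∀ {n} → S̃ n
Λ {n} = record
  { perm     = mk↔ₛ′ (_+ 1ℤ) (_- 1ℤ) solve-∀ solve-∀
  ; periodic = λ i → lemma i (+ n)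
  }
  where
  lemma : ∀ i m → i + m + 1ℤ ≡ i + 1ℤ + m
  lemma = solve-∀

data ⟨_⟩ {n} (X : Pred (S̃ n) 0ℓ) : Pred (S̃ n) 0ℓ where
  gen  : ∀ {f} → f ∈ X → f ∈ ⟨ X ⟩
  unit : e ∈ ⟨ X ⟩
  mul  : ∀ {f g} → f ∈ ⟨ X ⟩ → g ∈ ⟨ X ⟩ → f ∙ g ∈ ⟨ X ⟩
  inv  : ∀ {f} → f ∈ ⟨ X ⟩ → f ⁻¹ ∈ ⟨ X ⟩
  resp : ∀ {f g} → f ≈ g → f ∈ ⟨ X ⟩ → g ∈ ⟨ X ⟩

infixl 7 _∙ᶜ_
_∙ᶜ_ : ∀ {n} → S̃ n → Pred (S̃ n) 0ℓ → Pred (S̃ n) 0ℓ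
(x ∙ᶜ H) y = ∃ λ u → u ∈ H × y ≈ x ∙ u

[1⋯_] : ℕ → List ℤ
[1⋯ m ] = map (λ j → + ℕ.suc j) (upTo m)

-- (1/n) Σ_{i=1}^{n} (f(i) − i) = k, an equation in ℚ.
S̃⁽_⁾ : ∀ {n} .{{_ : NonZero n}} → ℕ → Pred (S̃ n) 0ℓ
S̃⁽_⁾ {n} k f = foldr _+_ 0ℤ (map (λ i → f ⟨$⟩ i - i) [1⋯ n ]) ℚ./ n ≡ + k ℚ./ 1

IsInversion : ∀ {n} → S̃ n → Pred (ℤ × ℤ) 0ℓ
IsInversion {n} f (a , b) = 1ℤ ≤ a × a ≤ + n × a < b × f ⟨$⟩ b < f ⟨$⟩ a

isInversion? : ∀ {n} (f : S̃ n) ab → Dec (IsInversion f ab)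
isInversion? {n} f (a , b) =
  (1ℤ ℤ.≤? a) ×-dec (a ℤ.≤? + n) ×-dec (a ℤ.<? b) ×-dec (f ⟨$⟩ b ℤ.<? f ⟨$⟩ a)

displacement : ∀ {n} → S̃ n → ℕ
displacement {n} f = sum (map (λ i → ∣ f ⟨$⟩ i - i ∣) [1⋯ n ])

-- Every integer is moved by at most D = displacement f, so an inversion (a , b)
-- satisfies 1 ≤ a ≤ n and 1 ≤ b ≤ n + 2D; hence the search below is exhaustive
-- (see ℓ-card).
inversions : ∀ {n} → S̃ n → List (ℤ × ℤ)
inversions {n} f =
  filter (isInversion? f)
         (cartesianProduct [1⋯ n ] [1⋯ n ℕ.+ 2 ℕ.* displacement f ])

ℓ : ∀ {n} → S̃ n → ℕ
ℓ f = length (inversions f)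

private
  ∈-range : ∀ {m a} → 1ℤ ≤ a → a ≤ + m → a ∈ˡ [1⋯ m ]
  ∈-range {a = + ℕ.suc j} _ (+≤+ j<m) = ∈-map⁺ (λ j → + ℕ.suc j) (∈-upTo⁺ j<m)
  ∈-range {a = + 0} (+≤+ ()) _

  unique-range : ∀ m → Unique [1⋯ m ]
  unique-range m = Unique.map⁺ (λ { refl → refl }) (Unique.upTo⁺ m)

  lookup-inj : ∀ {A : Set} {xs : List A} → Unique xs → ∀ i j → lookup xs i ≡ lookup xs j → i ≡ j
  lookup-inj (_ ∷ _)  Fin.zero    Fin.zero    _  = refl
  lookup-inj (p ∷ _)  Fin.zero    (Fin.suc j) eq = ⊥-elim (All.lookup p (∈-lookup j) eq)
  lookup-inj (p ∷ _)  (Fin.suc i) Fin.zero    eq = ⊥-elim (All.lookup p (∈-lookup i) (sym eq))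
  lookup-inj (_ ∷ ps) (Fin.suc i) (Fin.suc j) eq = cong Fin.suc (lookup-inj ps i j eq)

  ∈⇒≤sum : ∀ {A : Set} (g : A → ℕ) {x} {xs} → x ∈ˡ xs → g x ℕ.≤ sum (map g xs)
  ∈⇒≤sum g (here refl) = ℕ.m≤m+n _ _
  ∈⇒≤sum g (there p)   = ℕ.≤-trans (∈⇒≤sum g p) (ℕ.m≤n+m _ _)

shift : ∀ {n} (f : S̃ n) i q → f ⟨$⟩ (i + q * + n) ≡ f ⟨$⟩ i + q * + n
shift {n} f = go
  where
  step : ∀ i q m → i + (1ℤ + q) * m ≡ i + q * m + m
  step = solve-∀
  back : ∀ i q m → i ≡ i + (- q) * m + q * m
  back = solve-∀
  cancel : ∀ x q m → x + q * m + (- q) * m ≡ x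
  cancel = solve-∀
  zer : ∀ i m → i + 0ℤ * m ≡ i
  zer = solve-∀
  pos : ∀ i q → f ⟨$⟩ (i + + q * + n) ≡ f ⟨$⟩ i + + q * + n
  pos i ℕ.zero    = trans (cong (f ⟨$⟩_) (zer i (+ n))) (sym (zer _ (+ n)))
  pos i (ℕ.suc q) = begin
    f ⟨$⟩ (i + + ℕ.suc q * + n)      ≡⟨ cong (f ⟨$⟩_) (step i (+ q) (+ n)) ⟩
    f ⟨$⟩ (i + + q * + n + + n)      ≡⟨ periodic f _ ⟩
    f ⟨$⟩ (i + + q * + n) + + n      ≡⟨ cong (_+ + n) (pos i q) ⟩
    f ⟨$⟩ i + + q * + n + + n        ≡⟨ step (f ⟨$⟩ i) (+ q) (+ n) ⟨
    f ⟨$⟩ i + + ℕ.suc q * + n        ∎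
    where open ≡-Reasoning
  go : ∀ i q → f ⟨$⟩ (i + q * + n) ≡ f ⟨$⟩ i + q * + n
  go i (+ q)    = pos i q
  go i -[1+ q ] = begin
    f ⟨$⟩ j                                          ≡⟨ cancel _ (+ ℕ.suc q) (+ n) ⟨
    f ⟨$⟩ j + + ℕ.suc q * + n + -[1+ q ] * + n       ≡⟨ cong (_+ -[1+ q ] * + n) (pos j (ℕ.suc q)) ⟨
    f ⟨$⟩ (j + + ℕ.suc q * + n) + -[1+ q ] * + n     ≡⟨ cong (λ z → f ⟨$⟩ z + -[1+ q ] * + n) (back i (+ ℕ.suc q) (+ n)) ⟨
    f ⟨$⟩ i + -[1+ q ] * + n                         ∎
    where
    open ≡-Reasoning
    j = i + -[1+ q ] * + n

-- Every integer is uniquely  (1 + r) + q n  with  0 ≤ r < n.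

module _ {n : ℕ} .{{_ : NonZero n}} where

  fromWindow : ℤ × Fin n → ℤ
  fromWindow (q , r) = + ℕ.suc (toℕ r) + q * + n

  toWindow : ℤ → ℤ × Fin n
  toWindow a = (a - 1ℤ) /ℕ n , fromℕ< (n%ℕd<d (a - 1ℤ) n)

  fromWindow∘toWindow : ∀ a → fromWindow (toWindow a) ≡ a
  fromWindow∘toWindow a = begin
    + ℕ.suc (toℕ (fromℕ< (n%ℕd<d (a - 1ℤ) n))) + q * + n  ≡⟨ cong (λ r → + ℕ.suc r + q * + n) (toℕ-fromℕ< _) ⟩
    1ℤ + + ((a - 1ℤ) %ℕ n) + q * + n                      ≡⟨ ℤ.+-assoc 1ℤ (+ ((a - 1ℤ) %ℕ n)) (q * + n) ⟩
    1ℤ + (+ ((a - 1ℤ) %ℕ n) + q * + n)                    ≡⟨ cong (λ z → 1ℤ + z) (a≡a%ℕn+[a/ℕn]*n (a - 1ℤ) n) ⟨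
    1ℤ + (a - 1ℤ)                                         ≡⟨ lemma a ⟩
    a                                                     ∎
    where
    open ≡-Reasoning
    q = (a - 1ℤ) /ℕ n
    lemma : ∀ a → 1ℤ + (a - 1ℤ) ≡ a
    lemma = solve-∀

  quotient≮ : ∀ {q q′} (r r′ : Fin n) → fromWindow (q , r) ≡ fromWindow (q′ , r′) → ¬ (q < q′)
  quotient≮ {q} {q′} r r′ eq q<q′ = ℤ.<-irrefl eq (begin-strict
    + ℕ.suc (toℕ r) + q * + n    ≤⟨ ℤ.+-monoˡ-≤ (q * + n) (+≤+ (toℕ<n r)) ⟩
    + n + q * + n                ≡⟨ lemma q (+ n) ⟩
    (1ℤ + q) * + n               ≤⟨ ℤ.*-monoʳ-≤-nonNeg (+ n) (ℤ.i<j⇒suc[i]≤j q<q′) ⟩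
    q′ * + n                     ≡⟨ ℤ.+-identityˡ _ ⟨
    0ℤ + q′ * + n                <⟨ ℤ.+-monoˡ-< (q′ * + n) (+<+ ℕ.z<s) ⟩
    + ℕ.suc (toℕ r′) + q′ * + n  ∎)
    where
    open ℤ.≤-Reasoning
    lemma : ∀ q m → m + q * m ≡ (1ℤ + q) * m
    lemma = solve-∀

  fromWindow-inj : ∀ {x y} → fromWindow x ≡ fromWindow y → x ≡ y
  fromWindow-inj {q , r} {q′ , r′} eq
    with refl ← ℤ.≤-antisym {q} {q′} (ℤ.≮⇒≥ (quotient≮ {q′} {q} r′ r (sym eq))) (ℤ.≮⇒≥ (quotient≮ {q} {q′} r r′ eq))
    = cong (q ,_) (toℕ-injective (ℕ.suc-injective (ℤ.+-injective
        (∙-cancel (+ ℕ.suc (toℕ r)) (+ ℕ.suc (toℕ r′)) eq))))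
    where
    ∙-cancel : ∀ x y → x + q * + n ≡ y + q * + n → x ≡ y
    ∙-cancel x y p = trans (back x (q * + n)) (trans (cong (_- q * + n) p) (sym (back y (q * + n))))
      where
      back : ∀ x z → x ≡ x + z - z
      back = solve-∀

  window : ℤ ↔ (ℤ × Fin n)
  window = mk↔ₛ′ toWindow fromWindow (λ x → fromWindow-inj (fromWindow∘toWindow (fromWindow x))) fromWindow∘toWindow

  -- The affine permutation  (1 + r) + q n ↦ (1 + σ r) + (q + c r) n.
  windowed : (σ : Permutation′ n) (c : Fin n → ℤ) → S̃ n
  windowed σ c = record
    { perm     = window ⨾ (mid ⨾ flip↔ window)
    ; periodic = λ i → trans (cong (fromWindow ∘ Inverse.to mid) (to-shift i))
                             (lemma (+ ℕ.suc (toℕ (σ ⟨$⟩ʳ proj₂ (toWindow i)))) (proj₁ (toWindow i)) (c (proj₂ (toWindow i))) (+ n))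
    }
    where
    sub-add : ∀ x y → x - y + y ≡ x
    sub-add = solve-∀
    add-sub : ∀ x y → x + y - y ≡ x
    add-sub = solve-∀
    mid : (ℤ × Fin n) ↔ (ℤ × Fin n)
    mid = mk↔ₛ′
      (λ (q , r) → q + c r , σ ⟨$⟩ʳ r)
      (λ (q , r) → q - c (σ ⟨$⟩ˡ r) , σ ⟨$⟩ˡ r)
      (λ (q , r) → cong₂ _,_ (sub-add q _) (inverseʳ σ))
      (λ (q , r) → cong₂ _,_ (trans (cong (λ z → q + c r - c z) (inverseˡ σ)) (add-sub q (c r))) (inverseˡ σ))
    to-shift : ∀ i → toWindow (i + + n) ≡ (proj₁ (toWindow i) + 1ℤ , proj₂ (toWindow i))
    to-shift i = fromWindow-inj (begin
      fromWindow (toWindow (i + + n))  ≡⟨ fromWindow∘toWindow (i + + n) ⟩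
      i + + n                          ≡⟨ cong (_+ + n) (fromWindow∘toWindow i) ⟨
      R + Q * + n + + n                ≡⟨ assoc R Q (+ n) ⟩
      R + (Q + 1ℤ) * + n               ∎)
      where
      open ≡-Reasoning
      R = + ℕ.suc (toℕ (proj₂ (toWindow i)))
      Q = proj₁ (toWindow i)
      assoc : ∀ R Q m → R + Q * m + m ≡ R + (Q + 1ℤ) * m
      assoc = solve-∀
    lemma : ∀ R Q C m → R + (Q + 1ℤ + C) * m ≡ R + (Q + C) * m + m
    lemma = solve-∀

  windowed-spec : ∀ σ c r → windowed σ c ⟨$⟩ (+ ℕ.suc (toℕ r)) ≡ + ℕ.suc (toℕ (σ ⟨$⟩ʳ r)) + c r * + n
  windowed-spec σ c r = trans
    (cong (λ (q , r) → fromWindow (q + c r , σ ⟨$⟩ʳ r))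
      (fromWindow-inj {toWindow (+ ℕ.suc (toℕ r))} {0ℤ , r}
        (trans (fromWindow∘toWindow _) (sym (ℤ.+-identityʳ (+ ℕ.suc (toℕ r)))))))
    (cong (λ z → + ℕ.suc (toℕ (σ ⟨$⟩ʳ r)) + z * + n) (ℤ.+-identityˡ (c r)))

  private
    ∣displaced∣≤ : ∀ (f : S̃ n) b → ∣ f ⟨$⟩ b - b ∣ ℕ.≤ displacement f
    ∣displaced∣≤ f b = subst (λ z → ∣ z ∣ ℕ.≤ displacement f) (sym eq)
      (∈⇒≤sum (λ i → ∣ f ⟨$⟩ i - i ∣) (∈-range {n} (+≤+ (ℕ.s≤s ℕ.z≤n)) (+≤+ (toℕ<n r))))
      where
      q = proj₁ (toWindow b)
      r = proj₂ (toWindow b)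
      i = + ℕ.suc (toℕ r)
      lemma : ∀ x y z → (x + z) - (y + z) ≡ x - y
      lemma = solve-∀
      eq : f ⟨$⟩ b - b ≡ f ⟨$⟩ i - i
      eq = begin
        f ⟨$⟩ b - b                          ≡⟨ cong (λ z → f ⟨$⟩ z - z) (fromWindow∘toWindow b) ⟨
        f ⟨$⟩ (i + q * + n) - (i + q * + n)  ≡⟨ cong (_- (i + q * + n)) (shift f i q) ⟩
        f ⟨$⟩ i + q * + n - (i + q * + n)    ≡⟨ lemma (f ⟨$⟩ i) i (q * + n) ⟩
        f ⟨$⟩ i - i                          ∎
        where open ≡-Reasoning

    ≤∣∣ : ∀ x → x ≤ + ∣ x ∣
    ≤∣∣ (+ _)    = ℤ.≤-refl
    ≤∣∣ -[1+ _ ] = -≤+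

    upper : ∀ (f : S̃ n) {a b} → IsInversion f (a , b) → b ≤ + (n ℕ.+ 2 ℕ.* displacement f)
    upper f {a} {b} (_ , a≤n , _ , fb<fa) = begin
      b                                        ≡⟨ lemma₁ b (f ⟨$⟩ b) ⟩
      f ⟨$⟩ b + (b - f ⟨$⟩ b)                  ≤⟨ ℤ.+-mono-≤ (ℤ.<⇒≤ fb<fa) b-fb≤D ⟩
      f ⟨$⟩ a + + D                            ≡⟨ cong (_+ + D) (lemma₁ (f ⟨$⟩ a) a) ⟩
      a + (f ⟨$⟩ a - a) + + D                  ≤⟨ ℤ.+-monoˡ-≤ (+ D) (ℤ.+-mono-≤ a≤n fa-a≤D) ⟩
      + n + + D + + D                          ≡⟨ cong +_ (trans (ℕ.+-assoc n D D) (cong (λ z → n ℕ.+ (D ℕ.+ z)) (sym (ℕ.+-identityʳ D)))) ⟩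
      + (n ℕ.+ 2 ℕ.* D)                        ∎
      where
      open ℤ.≤-Reasoning
      D = displacement f
      lemma₁ : ∀ x y → x ≡ y + (x - y)
      lemma₁ = solve-∀
      fa-a≤D : f ⟨$⟩ a - a ≤ + D
      fa-a≤D = ℤ.≤-trans (≤∣∣ _) (+≤+ (∣displaced∣≤ f a))
      b-fb≤D : b - f ⟨$⟩ b ≤ + D
      b-fb≤D = ℤ.≤-trans (≤∣∣ _) (+≤+ (subst (ℕ._≤ D) (ℤ.∣i-j∣≡∣j-i∣ (f ⟨$⟩ b) b) (∣displaced∣≤ f b)))

    inversions-complete : ∀ (f : S̃ n) {ab} → IsInversion f ab → ab ∈ˡ inversions f
    inversions-complete f p@(1≤a , a≤n , a<b , _) =
      ∈-filter⁺ (isInversion? f)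
        (∈-cartesianProduct⁺ (∈-range 1≤a a≤n) (∈-range (ℤ.≤-trans 1≤a (ℤ.<⇒≤ a<b)) (upper f p))) p

    inversion-irrelevant : ∀ (f : S̃ n) {ab} (p q : IsInversion f ab) → p ≡ q
    inversion-irrelevant f (p₁ , p₂ , p₃ , p₄) (q₁ , q₂ , q₃ , q₄) =
      cong₂ _,_ (ℤ.≤-irrelevant p₁ q₁) (cong₂ _,_ (ℤ.≤-irrelevant p₂ q₂)
        (cong₂ _,_ (ℤ.<-irrelevant p₃ q₃) (ℤ.<-irrelevant p₄ q₄)))

  ℓ-card : (f : S̃ n) → Fin (ℓ f) ↔ Σ (ℤ × ℤ) (IsInversion f)
  ℓ-card f = mk↔ₛ′ to from to-from from-to
    where
    L-unique : Unique (inversions f)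
    L-unique = Unique.filter⁺ (isInversion? f) (Unique.cartesianProduct⁺ (unique-range n) (unique-range (n ℕ.+ 2 ℕ.* displacement f)))
    to : Fin (ℓ f) → Σ (ℤ × ℤ) (IsInversion f)
    to i = lookup (inversions f) i , proj₂ (∈-filter⁻ (isInversion? f) {xs = cartesianProduct [1⋯ n ] [1⋯ n ℕ.+ 2 ℕ.* displacement f ]} (∈-lookup {xs = inversions f} i))
    from : Σ (ℤ × ℤ) (IsInversion f) → Fin (ℓ f)
    from (_ , p) = index (inversions-complete f p)
    to-from : ∀ x → to (from x) ≡ x
    to-from (_ , p) = Σ-≡,≡→≡ (sym (lookup-index (inversions-complete f p)) , inversion-irrelevant f _ _)
    from-to : ∀ i → from (to i) ≡ i
    from-to i = lookup-inj L-unique _ i (sym (lookup-index (inversions-complete f (proj₂ (to i)))))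

module _ {n : ℕ} .{{_ : NonTrivial n}} where

  private instance
    n-nonZero : NonZero n
    n-nonZero = nonTrivial⇒nonZero n

  -- a ≡ i goes to a + 1, a ≡ i + 1 goes to a - 1 (mod n); disjoint because n ≥ 2.
  swap : ℕ → ℤ → ℤ
  swap i a =
    if does (+ n ∣? (a - + i)) then a + 1ℤ else
    if does (+ n ∣? (a - (+ i + 1ℤ))) then a - 1ℤ else
    a

  n∤1 : ¬ (+ n ∣ 1ℤ)
  n∤1 p = nonTrivial⇒≢1 (ℕ.∣1⇒≡1 (∣⇒∣ᵤ p))

  swap-up : ∀ i a → + n ∣ a - + i → swap i a ≡ a + 1ℤ
  swap-up i a p rewrite dec-true (+ n ∣? (a - + i)) p = refl

  ¬both : ∀ i a → + n ∣ a - (+ i + 1ℤ) → ¬ (+ n ∣ a - + i)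
  ¬both i a p q = n∤1 (subst (+ n ∣_) (lemma a (+ i)) (∣m∣n⇒∣m-n q p))
    where
    lemma : ∀ a i → (a - i) - (a - (i + 1ℤ)) ≡ 1ℤ
    lemma = solve-∀

  swap-down : ∀ i a → + n ∣ a - (+ i + 1ℤ) → swap i a ≡ a - 1ℤ
  swap-down i a p
    rewrite dec-false (+ n ∣? (a - + i)) (¬both i a p)
          | dec-true (+ n ∣? (a - (+ i + 1ℤ))) p = refl

  swap-fix : ∀ i a → ¬ (+ n ∣ a - + i) → ¬ (+ n ∣ a - (+ i + 1ℤ)) → swap i a ≡ a
  swap-fix i a p q
    rewrite dec-false (+ n ∣? (a - + i)) p
          | dec-false (+ n ∣? (a - (+ i + 1ℤ))) q = refl

  swap-involutive : ∀ i a → swap i (swap i a) ≡ a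
  swap-involutive i a with + n ∣? (a - + i) | + n ∣? (a - (+ i + 1ℤ))
  ... | yes p | _     = trans (cong (swap i) (swap-up i a p)) (trans (swap-down i (a + 1ℤ) (subst (+ n ∣_) (lemma a (+ i)) p)) (back a))
    where
    lemma : ∀ a i → a - i ≡ a + 1ℤ - (i + 1ℤ)
    lemma = solve-∀
    back : ∀ a → a + 1ℤ - 1ℤ ≡ a
    back = solve-∀
  ... | no _  | yes p = trans (cong (swap i) (swap-down i a p)) (trans (swap-up i (a - 1ℤ) (subst (+ n ∣_) (lemma a (+ i)) p)) (back a))
    where
    lemma : ∀ a i → a - (i + 1ℤ) ≡ a - 1ℤ - i
    lemma = solve-∀
    back : ∀ a → a - 1ℤ + 1ℤ ≡ a
    back = solve-∀
  ... | no p  | no q  = trans (cong (swap i) (swap-fix i a p q)) (swap-fix i a p q)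

  move : ∀ a m c → a + m - c ≡ a - c + m
  move = solve-∀

  ∣-shift : ∀ a c → + n ∣ a - c → + n ∣ a + + n - c
  ∣-shift a c p = subst (+ n ∣_) (sym (move a (+ n) c)) (∣m∣n⇒∣m+n p ∣-refl)

  ∣-unshift : ∀ a c → + n ∣ a + + n - c → + n ∣ a - c
  ∣-unshift a c p = ∣m+n∣n⇒∣m (subst (+ n ∣_) (move a (+ n) c) p) ∣-refl

  swap-periodic : ∀ i a → swap i (a + + n) ≡ swap i a + + n
  swap-periodic i a with + n ∣? (a - + i) | + n ∣? (a - (+ i + 1ℤ))
  ... | yes p | _     = trans (swap-up i (a + + n) (∣-shift a (+ i) p)) (trans (lemma a (+ n)) (cong (_+ + n) (sym (swap-up i a p))))
    where
    lemma : ∀ a m → a + m + 1ℤ ≡ a + 1ℤ + m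
    lemma = solve-∀
  ... | no _  | yes p = trans (swap-down i (a + + n) (∣-shift a (+ i + 1ℤ) p)) (trans (lemma a (+ n)) (cong (_+ + n) (sym (swap-down i a p))))
    where
    lemma : ∀ a m → a + m - 1ℤ ≡ a - 1ℤ + m
    lemma = solve-∀
  ... | no p  | no q  = trans (swap-fix i (a + + n) (p ∘ ∣-unshift a (+ i)) (q ∘ ∣-unshift a (+ i + 1ℤ))) (cong (_+ + n) (sym (swap-fix i a p q)))

  s : ℕ → S̃ n
  s i = record
    { perm     = mk↔ₛ′ (swap i) (swap i) (swap-involutive i) (swap-involutive i)
    ; periodic = swap-periodic i
    }

  J : Pred (S̃ n) 0ℓ
  J y = ∃ λ i → 1 ℕ.≤ i × i ℕ.< n × y ≈ s i

  Wᴶ : Pred (S̃ n) 0ℓ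
  Wᴶ = ⟨ J ⟩

  -- { s i | 0 ≤ i ≤ n - 1, ℓ (x s i) < ℓ x }, as a subset of S̃ n closed under ≈.
  rightDescents : S̃ n → Pred (S̃ n) 0ℓ
  rightDescents x y = ∃ λ i → i ℕ.< n × y ≈ s i × ℓ (x ∙ s i) ℕ.< ℓ x

  -- (S̃ₙ⁽ᵏ⁾)^J
  S̃⁽_⁾ᴶ : ℕ → Pred (S̃ n) 0ℓ
  S̃⁽ k ⁾ᴶ x = x ∈ S̃⁽ k ⁾ × (∀ t → t ∈ J → ℓ x ℕ.< ℓ (x ∙ t))

  IsMinimalIn : Pred (S̃ n) 0ℓ → S̃ n → Set
  IsMinimalIn C x = x ∈ C × (∀ y → y ∈ C → ℓ x ℕ.≤ ℓ y)

  IsUniqueMinimalIn : Pred (S̃ n) 0ℓ → S̃ n → Set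
  IsUniqueMinimalIn C x = IsMinimalIn C x × (∀ y → IsMinimalIn C y → y ≈ x)

  -- Periodic extension; position i ∈ {1, …, n} is the element i - 1 of Fin n.
  extend : Permutation′ n → S̃ n
  extend w = windowed w (λ _ → 0ℤ)

  -- r : Fin n stands for i = 1 + r, so  r < k  means  i ≤ k.
  τ-shift : ℕ → Fin n → ℤ
  τ-shift k r = if does (toℕ r ℕ.<? k) then 1ℤ else 0ℤ

  τ : ℕ → S̃ n
  τ k = windowed (↔-refl (Fin n)) (τ-shift k)

  extend-spec : ∀ w r → extend w ⟨$⟩ (+ ℕ.suc (toℕ r)) ≡ + ℕ.suc (toℕ (w ⟨$⟩ʳ r))
  extend-spec w r = trans (windowed-spec w (λ _ → 0ℤ) r) (ℤ.+-identityʳ _)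

  τ-spec-≤ : ∀ k r → toℕ r ℕ.< k → τ k ⟨$⟩ (+ ℕ.suc (toℕ r)) ≡ + ℕ.suc (toℕ r) + + n
  τ-spec-≤ k r r<k = trans (windowed-spec (↔-refl (Fin n)) (τ-shift k) r)
    (cong (λ z → + ℕ.suc (toℕ r) + z)
      (trans (cong (λ b → (if b then 1ℤ else 0ℤ) * + n) (dec-true (toℕ r ℕ.<? k) r<k)) (ℤ.*-identityˡ (+ n))))

  τ-spec-> : ∀ k r → k ℕ.≤ toℕ r → τ k ⟨$⟩ (+ ℕ.suc (toℕ r)) ≡ + ℕ.suc (toℕ r)
  τ-spec-> k r k≤r = trans (windowed-spec (↔-refl (Fin n)) (τ-shift k) r)
    (trans (cong (λ b → + ℕ.suc (toℕ r) + (if b then 1ℤ else 0ℤ) * + n) (dec-false (toℕ r ℕ.<? k) (ℕ.≤⇒≯ k≤r)))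
           (ℤ.+-identityʳ _))

  x[_,_] : ℕ → Permutation′ n → S̃ n
  x[ k , w ] = extend w ⁻¹ ∙ τ k

record IsGrassmannian {n} (k : ℕ) (w : Permutation′ n) : Set where
  -- 0-based positions: the first block is {i | toℕ i < k}, the second {i | k ≤ toℕ i}.
  field
    increasing-≤k : ∀ i j → i Fin.< j → toℕ j ℕ.< k → w ⟨$⟩ʳ i Fin.< w ⟨$⟩ʳ j
    increasing->k : ∀ i j → i Fin.< j → k ℕ.≤ toℕ i → w ⟨$⟩ʳ i Fin.< w ⟨$⟩ʳ j

{-# OPTIONS --safe #-}

-- Write x = x_w.  Since s_i acts on values from the right, s_i is a right
-- descent of x iff x⁻¹(i + 1) < x⁻¹(i): away from the pair of values i, i + 1
-- (mod n) the map s_i preserves order, so the inversion sets of x and x s_i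
-- are nested.  Now x⁻¹(i) is w(i) - n ≤ 0 for i ≤ k and w(i) > 0 for i > k,
-- so x⁻¹ is increasing on {1, …, n} exactly because w is k-Grassmannian, and
-- none of s_1, …, s_{n-1} is a descent.  If s_0 were not a descent either,
-- x⁻¹ would be increasing on ℤ, hence x a translation, and then x = Λᵏ by
-- averaging the displacement.
-- The elements u of W_J permute every window {qn + 1, …, qn + n}.  As x⁻¹ is
-- increasing on windows, the values of an inversion of x lie in different
-- windows, so it remains an inversion of x u; if x u has no others, then u is
-- increasing, hence a translation preserving windows, hence trivial.

module Submission where

open import Defs
open import Data.Bool.Base using (if_then_else_)
open import Data.Empty using (⊥-elim)
open import Data.Fin.Base as Fin using (Fin; toℕ; fromℕ<)
open import Data.Fin.Permutation using (Permutation′; _⟨$⟩ʳ_; _⟨$⟩ˡ_; inverseʳ; flip)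
open import Data.Fin.Properties using (toℕ<n; toℕ-fromℕ<; injective⇒≤)
open import Data.Integer.Base as ℤ using (ℤ; +_; -[1+_]; _+_; _-_; -_; _*_; 0ℤ; 1ℤ; +≤+; +<+)
open import Data.Integer.Divisibility.Signed using (_∣_; _∣?_; divides)
import Data.Integer.Properties as ℤ
open import Data.Integer.Tactic.RingSolver using (solve-∀)
open import Data.List.Base using (map; foldr; applyUpTo)
open import Data.Nat.Base as ℕ using (ℕ; suc; NonZero; NonTrivial; nonTrivial⇒nonZero; nonTrivial⇒n>1; _≤_; _<_; z≤n; s≤s)
import Data.Nat.Properties as ℕ
open import Data.Product.Base using (_×_; _,_; proj₁; proj₂; Σ)
open import Data.Rational.Base as ℚ using ()
import Data.Rational.Properties as ℚ
open import Data.Rational.Unnormalised.Base using (mkℚᵘ; *≡*)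
open import Data.Sum.Base using (inj₁; inj₂)
open import Function.Base using (_∘_; id)
open import Function.Bundles using (_↔_; Inverse; Injection)
open import Function.Construct.Identity using () renaming (↔-id to ↔-refl)
open import Function.Construct.Symmetry using (↔-sym)
open import Function.Definitions using (Injective)
open import Function.Properties.Inverse using (↔⇒↣)
open import Relation.Binary.Definitions using (tri<; tri≈; tri>)
open import Relation.Binary.PropositionalEquality using (_≡_; _≢_; refl; sym; trans; cong; subst; subst₂; module ≡-Reasoning)
open import Relation.Nullary.Decidable using (yes; no; does; dec-true; dec-false)
open import Relation.Nullary.Negation using (¬_)
open import Relation.Unary using (_∈_; _≐_)

open import Algebra.Properties.CommutativeMonoid.Sum ℤ.+-0-commutativeMonoid using (sum; sum-cong-≗; sum-permute; ∑-distrib-+)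

-- Increasing maps and translations of the integers.

↔-injective : ∀ {A B : Set} (φ : A ↔ B) → Injective _≡_ _≡_ (Inverse.to φ)
↔-injective φ = Injection.injective (↔⇒↣ φ)

i<i+1 : ∀ i → i ℤ.< i + 1ℤ
i<i+1 i = subst (ℤ._< i + 1ℤ) (ℤ.+-identityʳ i) (ℤ.+-monoʳ-< i (+<+ ℕ.z<s))

i<j⇒i+1≤j : ∀ {i j} → i ℤ.< j → i + 1ℤ ℤ.≤ j
i<j⇒i+1≤j {i} i<j = subst (ℤ._≤ _) (ℤ.+-comm 1ℤ i) (ℤ.i<j⇒suc[i]≤j i<j)

Increasing : (ℤ → ℤ) → Set
Increasing g = ∀ {a b} → a ℤ.< b → g a ℤ.< g b

stepwise⇒increasing : ∀ g → (∀ a → g a ℤ.< g (a + 1ℤ)) → Increasing g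
stepwise⇒increasing g step {a} {b} a<b = subst (λ z → g a ℤ.< g z) a+d≡b (go (ℤ.∣ b - a - 1ℤ ∣))
  where
  assoc : ∀ a m → a + (1ℤ + m) + 1ℤ ≡ a + (1ℤ + (1ℤ + m))
  assoc = solve-∀
  -- Induction on the gap minus one, since the gap `b - a` is at least 1.
  go : ∀ m → g a ℤ.< g (a + + suc m)
  go 0       = step a
  go (suc m) = ℤ.<-trans (go m) (subst (λ z → g (a + + suc m) ℤ.< g z) (assoc a (+ m)) (step (a + + suc m)))
  cancel : ∀ a b → a + (1ℤ + (b - a - 1ℤ)) ≡ b
  cancel = solve-∀
  regroup : ∀ a b → b - (a + 1ℤ) ≡ b - a - 1ℤ
  regroup = solve-∀
  a+d≡b : a + + suc (ℤ.∣ b - a - 1ℤ ∣) ≡ b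
  a+d≡b = trans
    (cong (λ z → a + (1ℤ + z)) (ℤ.0≤i⇒+∣i∣≡i (subst (0ℤ ℤ.≤_) (regroup a b) (ℤ.i≤j⇒0≤j-i (i<j⇒i+1≤j a<b)))))
    (cancel a b)

unit-steps⇒translation : ∀ g → (∀ a → g (a + 1ℤ) ≡ g a + 1ℤ) → ∀ a → g a ≡ g 0ℤ + a
unit-steps⇒translation g step = go
  where
  assoc : ∀ x m → x + m + 1ℤ ≡ x + (1ℤ + m)
  assoc = solve-∀
  cancel : ∀ x → x ≡ x + 1ℤ - 1ℤ
  cancel = solve-∀
  assoc⁻ : ∀ x m → x + m - 1ℤ ≡ x + (m - 1ℤ)
  assoc⁻ = solve-∀
  down : ∀ a → g a ≡ g (a + 1ℤ) - 1ℤ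
  down a = trans (cancel (g a)) (cong (_- 1ℤ) (sym (step a)))
  go : ∀ a → g a ≡ g 0ℤ + a
  go (+ 0)       = sym (ℤ.+-identityʳ (g 0ℤ))
  go (+ suc m)   = trans (cong g (ℤ.+-comm 1ℤ (+ m)))
    (trans (step (+ m)) (trans (cong (_+ 1ℤ) (go (+ m))) (assoc (g 0ℤ) (+ m))))
  go -[1+ 0 ]    = down -[1+ 0 ]
  -- Here `-[1+ m ] - 1ℤ` computes to `-[1+ suc (m + 0) ]`, hence the closing `ℕ.+-identityʳ`.
  go -[1+ suc m ] = trans (down -[1+ suc m ])
    (trans (cong (_- 1ℤ) (go -[1+ m ]))
      (trans (assoc⁻ (g 0ℤ) -[1+ m ]) (cong (λ j → g 0ℤ + -[1+ suc j ]) (ℕ.+-identityʳ m))))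

module _ {n : ℕ} (f : S̃ n) where

  ⟨$⟩-injective : ∀ {a b} → f ⟨$⟩ a ≡ f ⟨$⟩ b → a ≡ b
  ⟨$⟩-injective = ↔-injective (perm f)

  inverse-increasing : Increasing ((f ⁻¹) ⟨$⟩_) → Increasing (f ⟨$⟩_)
  inverse-increasing inc {a} {b} a<b with ℤ.<-cmp (f ⟨$⟩ a) (f ⟨$⟩ b)
  ... | tri< fa<fb _ _ = fa<fb
  ... | tri≈ _ eq _    = ⊥-elim (ℤ.<-irrefl (⟨$⟩-injective eq) a<b)
  ... | tri> _ _ fb<fa = ⊥-elim (ℤ.<-asym a<b
    (subst₂ ℤ._<_ (Inverse.strictlyInverseʳ (perm f) b) (Inverse.strictlyInverseʳ (perm f) a) (inc fb<fa)))

-- Nothing lies strictly between f(a) and f(a + 1): its preimage would lie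
-- strictly between a and a + 1.
increasing⇒translation : ∀ {n} (f : S̃ n) → Increasing (f ⟨$⟩_) → ∀ a → f ⟨$⟩ a ≡ f ⟨$⟩ 0ℤ + a
increasing⇒translation f inc = unit-steps⇒translation (f ⟨$⟩_) step
  where
  inc⁻¹ : Increasing ((f ⁻¹) ⟨$⟩_)
  inc⁻¹ = inverse-increasing (f ⁻¹) inc
  step : ∀ a → f ⟨$⟩ (a + 1ℤ) ≡ f ⟨$⟩ a + 1ℤ
  step a = ℤ.≤-antisym
    (ℤ.≮⇒≥ λ gap → ℤ.<-irrefl refl (ℤ.<-≤-trans
      (subst ((f ⁻¹) ⟨$⟩ (f ⟨$⟩ a + 1ℤ) ℤ.<_) (Inverse.strictlyInverseʳ (perm f) (a + 1ℤ)) (inc⁻¹ gap))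
      (i<j⇒i+1≤j (subst (ℤ._< (f ⁻¹) ⟨$⟩ (f ⟨$⟩ a + 1ℤ)) (Inverse.strictlyInverseʳ (perm f) a) (inc⁻¹ (i<i+1 (f ⟨$⟩ a)))))))
    (i<j⇒i+1≤j (inc (i<i+1 a)))

Λ^k-spec : ∀ {n} k a → (Λ {n} ^ k) ⟨$⟩ a ≡ a + + k
Λ^k-spec 0       a = sym (ℤ.+-identityʳ a)
Λ^k-spec (suc k) a = trans (Λ^k-spec k (a + 1ℤ)) (ℤ.+-assoc a 1ℤ (+ k))

-- Comparing lengths

infix 4 _⊑_
-- Inclusion of inversion sets, taken over all pairs of integers and not only those with `a` in the
-- window, so that it can be verified without normalising pairs.
_⊑_ : ∀ {n} → S̃ n → S̃ n → Set
f ⊑ g = ∀ {a b} → a ℤ.< b → f ⟨$⟩ b ℤ.< f ⟨$⟩ a → g ⟨$⟩ b ℤ.< g ⟨$⟩ a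

module _ {n : ℕ} .{{_ : NonZero n}} where

  private
    Inv : S̃ n → Set
    Inv f = Σ (ℤ × ℤ) (IsInversion f)

  Inv-≡ : ∀ f {p q : Inv f} → proj₁ p ≡ proj₁ q → p ≡ q
  Inv-≡ f {_ , (p₁ , p₂ , p₃ , p₄)} {_ , (q₁ , q₂ , q₃ , q₄)} refl
    rewrite ℤ.≤-irrelevant p₁ q₁ | ℤ.≤-irrelevant p₂ q₂ | ℤ.<-irrelevant p₃ q₃ | ℤ.<-irrelevant p₄ q₄ = refl

  module _ {f g : S̃ n} {l m} (card-f : Fin l ↔ Inv f) (card-g : Fin m ↔ Inv g) (f⊑g : f ⊑ g) where

    private
      include : Inv f → Inv g
      include (ab , 1≤a , a≤n , a<b , fb<fa) = ab , 1≤a , a≤n , a<b , f⊑g a<b fb<fa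

      incl : Fin l → Inv g
      incl i = include (Inverse.to card-f i)

      incl-injective : Injective _≡_ _≡_ incl
      incl-injective {i} {j} eq = ↔-injective card-f (Inv-≡ f (cong proj₁ eq))

    card-mono-≤ : l ≤ m
    card-mono-≤ = injective⇒≤ {f = Inverse.from card-g ∘ incl} (incl-injective ∘ ↔-injective (↔-sym card-g))

    -- The inversion `p` of `g` is missed by the inclusion, so sending `zero` to it gives an
    -- injection from `Fin (suc l)`.
    card-mono-< : (p : Inv g) → ¬ IsInversion f (proj₁ p) → l < m
    card-mono-< p p∉f = injective⇒≤ {f = Inverse.from card-g ∘ φ} (φ-injective ∘ ↔-injective (↔-sym card-g))
      where
      φ : Fin (suc l) → Inv g
      φ Fin.zero    = p
      φ (Fin.suc i) = incl i
      p∉incl : ∀ i → proj₁ p ≢ proj₁ (incl i)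
      p∉incl i eq = p∉f (subst (IsInversion f) (sym eq) (proj₂ (Inverse.to card-f i)))
      φ-injective : Injective _≡_ _≡_ φ
      φ-injective {Fin.zero}  {Fin.zero}  _  = refl
      φ-injective {Fin.zero}  {Fin.suc j} eq = ⊥-elim (p∉incl j (cong proj₁ eq))
      φ-injective {Fin.suc i} {Fin.zero}  eq = ⊥-elim (p∉incl i (sym (cong proj₁ eq)))
      φ-injective {Fin.suc i} {Fin.suc j} eq = cong Fin.suc (incl-injective eq)

  module _ {f g : S̃ n} (f⊑g : f ⊑ g) where

    ℓ-mono-≤ : ℓ f ≤ ℓ g
    ℓ-mono-≤ = card-mono-≤ {f} {g} (ℓ-card f) (ℓ-card g) f⊑g

    -- Lengths only count pairs with first entry in {1, ..., n}. Shifting `a` and `b` by a common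
    -- multiple of `n` brings `a` there and, by periodicity, preserves both comparisons of values.
    ℓ-mono-< : ∀ {a b} → a ℤ.< b → f ⟨$⟩ a ℤ.< f ⟨$⟩ b → g ⟨$⟩ b ℤ.< g ⟨$⟩ a → ℓ f < ℓ g
    ℓ-mono-< {a} {b} a<b fa<fb gb<ga = card-mono-< {f} {g} (ℓ-card f) (ℓ-card g) f⊑g new
      λ (_ , _ , _ , fb′<fa′) → ℤ.<-asym fa′<fb′ fb′<fa′
      where
      q : ℤ
      q = - proj₁ (toWindow {n} a)
      r : Fin n
      r = proj₂ (toWindow {n} a)
      a′ b′ : ℤ
      a′ = + suc (toℕ r)
      b′ = b + q * + n
      cancel : ∀ r q m → r + q * m + (- q) * m ≡ r
      cancel = solve-∀
      a≡ : a + q * + n ≡ a′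
      a≡ = trans (cong (_+ q * + n) (sym (fromWindow∘toWindow {n} a))) (cancel a′ (proj₁ (toWindow {n} a)) (+ n))
      shift-a : ∀ (h : S̃ n) → h ⟨$⟩ a + q * + n ≡ h ⟨$⟩ a′
      shift-a h = trans (sym (shift h a q)) (cong (h ⟨$⟩_) a≡)
      new : Inv g
      new = (a′ , b′) , +≤+ (s≤s z≤n) , +≤+ (toℕ<n r)
          , subst (ℤ._< b′) a≡ (ℤ.+-monoˡ-< (q * + n) a<b)
          , subst₂ ℤ._<_ (sym (shift g b q)) (shift-a g) (ℤ.+-monoˡ-< (q * + n) gb<ga)
      fa′<fb′ : f ⟨$⟩ a′ ℤ.< f ⟨$⟩ b′
      fa′<fb′ = subst₂ ℤ._<_ (shift-a f) (sym (shift f b q)) (ℤ.+-monoˡ-< (q * + n) fa<fb)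

  ℓ-cong : ∀ {f g : S̃ n} → f ≈ g → ℓ f ≡ ℓ g
  ℓ-cong {f} {g} f≈g = ℕ.≤-antisym
    (ℓ-mono-≤ {f = f} {g = g} λ {a} {b} _ → subst₂ ℤ._<_ (f≈g b) (f≈g a))
    (ℓ-mono-≤ {f = g} {g = f} λ {a} {b} _ → subst₂ ℤ._<_ (sym (f≈g b)) (sym (f≈g a)))

-- Windows

module _ {n : ℕ} .{{_ : NonZero n}} where

  -- The index q of the window {qn + 1, ..., qn + n} that contains the argument.
  quotient : ℤ → ℤ
  quotient a = proj₁ (toWindow {n} a)

  quotient-residue : ∀ {j} q → j < n → quotient (+ suc j + q * + n) ≡ q
  quotient-residue {j} q j<n = trans
    (cong (λ r → quotient (+ suc r + q * + n)) (sym (toℕ-fromℕ< j<n)))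
    (cong proj₁ (Inverse.strictlyInverseˡ (window {n}) (q , fromℕ< j<n)))

  fromWindow-monoʳ-< : ∀ q {r r′ : Fin n} → r Fin.< r′ → fromWindow (q , r) ℤ.< fromWindow (q , r′)
  fromWindow-monoʳ-< q r<r′ = ℤ.+-monoˡ-< (q * + n) (+<+ (s≤s r<r′))

  fromWindow-cancelʳ-< : ∀ q (r r′ : Fin n) → fromWindow (q , r) ℤ.< fromWindow (q , r′) → r Fin.< r′
  fromWindow-cancelʳ-< q r r′ lt with toℕ r ℕ.<? toℕ r′
  ... | yes r<r′ = r<r′
  ... | no  r≮r′ = ⊥-elim (ℤ.<⇒≱ lt (ℤ.+-monoˡ-≤ (q * + n) (+≤+ (s≤s (ℕ.≮⇒≥ r≮r′)))))

  -- Window q ends at (1 + q)n ≤ q′n, just before window q′ or earlier.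
  fromWindow-monoˡ-< : ∀ {q q′} (r r′ : Fin n) → q ℤ.< q′ → fromWindow (q , r) ℤ.< fromWindow (q′ , r′)
  fromWindow-monoˡ-< {q} {q′} r r′ q<q′ = begin-strict
    + suc (toℕ r) + q * + n    ≤⟨ ℤ.+-monoˡ-≤ (q * + n) (+≤+ (toℕ<n r)) ⟩
    + n + q * + n              ≡⟨ lemma q (+ n) ⟩
    (1ℤ + q) * + n             ≤⟨ ℤ.*-monoʳ-≤-nonNeg (+ n) (ℤ.i<j⇒suc[i]≤j q<q′) ⟩
    q′ * + n                   ≡⟨ ℤ.+-identityˡ _ ⟨
    0ℤ + q′ * + n              <⟨ ℤ.+-monoˡ-< (q′ * + n) (+<+ ℕ.z<s) ⟩
    + suc (toℕ r′) + q′ * + n  ∎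
    where
    open ℤ.≤-Reasoning
    lemma : ∀ q m → m + q * m ≡ (1ℤ + q) * m
    lemma = solve-∀

  quotient-cancel-< : ∀ {a b} → quotient a ℤ.< quotient b → a ℤ.< b
  quotient-cancel-< {a} {b} lt = subst₂ ℤ._<_ (fromWindow∘toWindow {n} a) (fromWindow∘toWindow {n} b)
    (fromWindow-monoˡ-< (proj₂ (toWindow {n} a)) (proj₂ (toWindow {n} b)) lt)

  quotient-mono-≤ : ∀ {a b} → a ℤ.≤ b → quotient a ℤ.≤ quotient b
  quotient-mono-≤ a≤b = ℤ.≮⇒≥ λ lt → ℤ.≤⇒≯ a≤b (quotient-cancel-< lt)

  quotient[0]<quotient[1] : quotient 0ℤ ℤ.< quotient 1ℤ
  quotient[0]<quotient[1] = subst₂ ℤ._<_ (sym q₀) (sym q₁) ℤ.-<+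
    where
    q₁ : quotient 1ℤ ≡ 0ℤ
    q₁ = quotient-residue 0ℤ (ℕ.>-nonZero⁻¹ n)
    cancel : ∀ m → m + - 1ℤ * m ≡ 0ℤ
    cancel = solve-∀
    q₀ : quotient 0ℤ ≡ - 1ℤ
    -- 0 is the last element of window -1, written as n + (-1)n.
    q₀ = trans
      (cong quotient (trans (sym (cancel (+ n))) (cong (λ m → + m + - 1ℤ * + n) (sym (ℕ.suc-pred n)))))
      (quotient-residue (- 1ℤ) (ℕ.≤-reflexive (ℕ.suc-pred n)))

  -- Window-preserving elements and minimal length in cosets.

  WindowPreserving : S̃ n → Set
  WindowPreserving u = ∀ a → quotient (u ⟨$⟩ a) ≡ quotient a

  WindowIncreasing : S̃ n → Set
  WindowIncreasing g = ∀ {a b} → quotient a ≡ quotient b → a ℤ.< b → g ⟨$⟩ a ℤ.< g ⟨$⟩ b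

  -- Being increasing, `u` is translation by u(0). A positive translation would carry 0 out of its
  -- window, a negative one would carry 1 out of its window, because a window boundary separates 0
  -- from 1.
  increasing∧preserving⇒≈e : ∀ u → WindowPreserving u → Increasing (u ⟨$⟩_) → u ≈ e
  increasing∧preserving⇒≈e u pres inc a =
    trans (transl a) (trans (cong (_+ a) u0≡0) (ℤ.+-identityˡ a))
    where
    transl : ∀ a → u ⟨$⟩ a ≡ u ⟨$⟩ 0ℤ + a
    transl = increasing⇒translation u inc
    u0≡0 : u ⟨$⟩ 0ℤ ≡ 0ℤ
    u0≡0 with ℤ.<-cmp (u ⟨$⟩ 0ℤ) 0ℤ
    ... | tri≈ _ eq _ = eq
    ... | tri> _ _ 0<c = ⊥-elim (ℤ.<⇒≱ quotient[0]<quotient[1]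
      (subst (quotient 1ℤ ℤ.≤_) (pres 0ℤ) (quotient-mono-≤ (i<j⇒i+1≤j 0<c))))
    ... | tri< c<0 _ _ = ⊥-elim (ℤ.<⇒≱ quotient[0]<quotient[1]
      (subst (ℤ._≤ quotient 0ℤ) (trans (cong quotient (sym (transl 1ℤ))) (pres 1ℤ)) (quotient-mono-≤ (i<j⇒i+1≤j c<0))))

  module _ {x u : S̃ n} (inc : WindowIncreasing (x ⁻¹)) (pres : WindowPreserving u) where

    WindowIncreasing⇒⊑ : x ⊑ x ∙ u
    WindowIncreasing⇒⊑ {a} {b} a<b xb<xa with ℤ.<-cmp (quotient (x ⟨$⟩ b)) (quotient (x ⟨$⟩ a))
    ... | tri< lt _ _ = quotient-cancel-< (subst₂ ℤ._<_ (sym (pres _)) (sym (pres _)) lt)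
    -- Within one window x⁻¹ preserves order, so x(b) < x(a) would give b < a.
    ... | tri≈ _ eq _ = ⊥-elim (ℤ.<-asym a<b
      (subst₂ ℤ._<_ (Inverse.strictlyInverseʳ (perm x) b) (Inverse.strictlyInverseʳ (perm x) a) (inc eq xb<xa)))
    ... | tri> _ _ gt = ⊥-elim (ℤ.<-asym xb<xa (quotient-cancel-< gt))

    -- A pair c < d reversed by `u` must share a window. Then the positions x⁻¹(c) < x⁻¹(d) form an
    -- inversion of `x ∙ u` but not of `x`, which would make `x ∙ u` strictly longer. So `u`
    -- reverses nothing.
    ℓ-coset-min⇒≈e : ℓ (x ∙ u) ≤ ℓ x → u ≈ e
    ℓ-coset-min⇒≈e ℓxu≤ℓx = increasing∧preserving⇒≈e u pres u-inc
      where
      u-inc : Increasing (u ⟨$⟩_)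
      u-inc {c} {d} c<d with ℤ.<-cmp (quotient c) (quotient d)
      ... | tri< lt _ _ = quotient-cancel-< (subst₂ ℤ._<_ (sym (pres c)) (sym (pres d)) lt)
      ... | tri> _ _ gt = ⊥-elim (ℤ.<-asym c<d (quotient-cancel-< gt))
      ... | tri≈ _ eq _ with ℤ.<-cmp (u ⟨$⟩ c) (u ⟨$⟩ d)
      ...   | tri< lt _ _  = lt
      ...   | tri≈ _ eq′ _ = ⊥-elim (ℤ.<-irrefl (⟨$⟩-injective u eq′) c<d)
      ...   | tri> _ _ gt  = ⊥-elim (ℕ.<⇒≱ (ℓ-mono-< {f = x} {g = x ∙ u} WindowIncreasing⇒⊑ (inc eq c<d)
                (subst₂ ℤ._<_ (sym (x∘x⁻¹ c)) (sym (x∘x⁻¹ d)) c<d)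
                (subst₂ (λ y z → u ⟨$⟩ y ℤ.< u ⟨$⟩ z) (sym (x∘x⁻¹ d)) (sym (x∘x⁻¹ c)) gt)) ℓxu≤ℓx)
        where
        x∘x⁻¹ : ∀ a → x ⟨$⟩ ((x ⁻¹) ⟨$⟩ a) ≡ a
        x∘x⁻¹ = Inverse.strictlyInverseˡ (perm x)

-- Multiplication by the generators

module _ {n : ℕ} .{{_ : NonTrivial n}} where

  private instance
    n-nonZero : NonZero n
    n-nonZero = nonTrivial⇒nonZero n

  swap-≤ : ∀ i a → ¬ (+ n ∣ a - + i) → swap {n} i a ℤ.≤ a
  swap-≤ i a ¬up with + n ∣? (a - (+ i + 1ℤ))
  ... | yes p = subst (ℤ._≤ a) (sym (swap-down i a p)) (ℤ.i-j≤i a 1ℤ)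
  ... | no  p = ℤ.≤-reflexive (swap-fix i a ¬up p)

  swap-≥ : ∀ i a → ¬ (+ n ∣ a - (+ i + 1ℤ)) → a ℤ.≤ swap {n} i a
  swap-≥ i a ¬down with + n ∣? (a - + i)
  ... | yes p = subst (a ℤ.≤_) (sym (swap-up i a p)) (ℤ.<⇒≤ (i<i+1 a))
  ... | no  p = ℤ.≤-reflexive (sym (swap-fix i a p ¬down))

  swap-≤+1 : ∀ i a → swap {n} i a ℤ.≤ a + 1ℤ
  swap-≤+1 i a with + n ∣? (a - + i)
  ... | yes p = ℤ.≤-reflexive (swap-up i a p)
  ... | no  p = ℤ.≤-trans (swap-≤ i a p) (ℤ.<⇒≤ (i<i+1 a))

  swap-≥-1 : ∀ i a → a - 1ℤ ℤ.≤ swap {n} i a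
  swap-≥-1 i a with + n ∣? (a - (+ i + 1ℤ))
  ... | yes p = ℤ.≤-reflexive (sym (swap-down i a p))
  ... | no  p = ℤ.≤-trans (ℤ.i-j≤i a 1ℤ) (swap-≥ i a p)

  swap-i : ∀ i → swap {n} i (+ i) ≡ + i + 1ℤ
  swap-i i = swap-up i (+ i) (divides 0ℤ (ℤ.+-inverseʳ (+ i)))

  swap-i+1 : ∀ i → swap {n} i (+ i + 1ℤ) ≡ + i
  swap-i+1 i = trans (cong (swap i) (sym (swap-i i))) (swap-involutive i (+ i))

  -- Each value moves by at most 1. At gap 2 or more the order therefore survives weakly, and
  -- strictly by injectivity. At gap 1, `c` cannot move up nor `c + 1` down, since either would make
  -- them a swapped pair.
  swap-mono-< : ∀ i {c d} → c ℤ.< d → ¬ (+ n ∣ c - + i × d ≡ c + 1ℤ) → swap {n} i c ℤ.< swap {n} i d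
  swap-mono-< i {c} {d} c<d ¬pair with ℤ.<-cmp (c + 1ℤ) d
  ... | tri< c+1<d _ _ = ℤ.≤∧≢⇒<
    (ℤ.≤-trans (swap-≤+1 i c) (ℤ.≤-trans (subst (c + 1ℤ ℤ.≤_) (ℤ.+-comm (- 1ℤ) d) (ℤ.i<j⇒i≤pred[j] c+1<d)) (swap-≥-1 i d)))
    (λ eq → ℤ.<-irrefl (⟨$⟩-injective (s i) eq) c<d)
  ... | tri≈ _ refl _ = begin-strict
    swap i c         ≤⟨ swap-≤ i c (λ p → ¬pair (p , refl)) ⟩
    c                <⟨ i<i+1 c ⟩
    c + 1ℤ           ≤⟨ swap-≥ i (c + 1ℤ) (λ p → ¬pair (subst (+ n ∣_) (cancel c (+ i)) p , refl)) ⟩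
    swap i (c + 1ℤ)  ∎
    where
    open ℤ.≤-Reasoning
    cancel : ∀ c i → c + 1ℤ - (i + 1ℤ) ≡ c - i
    cancel = solve-∀
  ... | tri> _ _ d<c+1 = ⊥-elim (ℤ.<⇒≱ d<c+1 (i<j⇒i+1≤j c<d))

  -- The only values that `s i` reverses are the translates of i, i + 1, and by periodicity all of
  -- these occur in ascending order in `f`. So no inversion is lost, and the positions of i and i +
  -- 1 supply a new one.
  ascent : ∀ (f : S̃ n) i → (f ⁻¹) ⟨$⟩ (+ i) ℤ.< (f ⁻¹) ⟨$⟩ (+ i + 1ℤ) → ℓ f < ℓ (f ∙ s i)
  ascent f i asc = ℓ-mono-< {f = f} {g = f ∙ s i} f⊑fs asc
    (subst₂ ℤ._<_ (sym (f∘f⁻¹ (+ i))) (sym (f∘f⁻¹ (+ i + 1ℤ))) (i<i+1 (+ i)))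
    (subst₂ ℤ._<_
      (sym (trans (cong (swap i) (f∘f⁻¹ (+ i + 1ℤ))) (swap-i+1 i)))
      (sym (trans (cong (swap i) (f∘f⁻¹ (+ i))) (swap-i i)))
      (i<i+1 (+ i)))
    where
    f⁻¹ : ℤ → ℤ
    f⁻¹ = (f ⁻¹) ⟨$⟩_
    f∘f⁻¹ : ∀ a → f ⟨$⟩ f⁻¹ a ≡ a
    f∘f⁻¹ = Inverse.strictlyInverseˡ (perm f)
    f⁻¹∘f : ∀ a → f⁻¹ (f ⟨$⟩ a) ≡ a
    f⁻¹∘f = Inverse.strictlyInverseʳ (perm f)
    solve-for : ∀ c i → c ≡ i + (c - i)
    solve-for = solve-∀
    carry : ∀ c i → c + 1ℤ ≡ i + 1ℤ + (c - i)
    carry = solve-∀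
    f⊑fs : f ⊑ f ∙ s i
    -- If f(b) = i + qn and f(a) = i + 1 + qn, then `asc` shifted by qn reads b < a.
    f⊑fs {a} {b} a<b fb<fa = swap-mono-< i fb<fa λ (divides q eq , fa≡fb+1) →
      let fb≡ = trans (solve-for (f ⟨$⟩ b) (+ i)) (cong (λ z → + i + z) eq)
          fa≡ = trans fa≡fb+1 (trans (carry (f ⟨$⟩ b) (+ i)) (cong (λ z → + i + 1ℤ + z) eq))
      in  ℤ.<-asym a<b (subst₂ ℤ._<_
            (trans (sym (shift (f ⁻¹) (+ i) q)) (trans (cong f⁻¹ (sym fb≡)) (f⁻¹∘f b)))
            (trans (sym (shift (f ⁻¹) (+ i + 1ℤ) q)) (trans (cong f⁻¹ (sym fa≡)) (f⁻¹∘f a)))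
            (ℤ.+-monoˡ-< (q * + n) asc))

  -- Multiplying by `s i` exchanges the positions of i and i + 1, so `f ∙ s i` has an ascent there,
  -- and `s i` is an involution.
  descent : ∀ (f : S̃ n) i → (f ⁻¹) ⟨$⟩ (+ i + 1ℤ) ℤ.< (f ⁻¹) ⟨$⟩ (+ i) → ℓ (f ∙ s i) < ℓ f
  descent f i desc = subst (ℓ (f ∙ s i) <_)
    (ℓ-cong {f = f ∙ s i ∙ s i} {g = f} (λ a → swap-involutive i (f ⟨$⟩ a)))
    (ascent (f ∙ s i) i (subst₂ (λ y z → (f ⁻¹) ⟨$⟩ y ℤ.< (f ⁻¹) ⟨$⟩ z) (sym (swap-i i)) (sym (swap-i+1 i)) desc))

  -- The parabolic subgroup preserves windows.

  quotient-step : ∀ {i} q → 1 ≤ i → i < n → quotient {n} (+ i + q * + n) ≡ quotient {n} (+ i + q * + n + 1ℤ)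
  quotient-step {suc j} q _ i<n = trans (quotient-residue q (ℕ.<⇒≤ i<n))
    (sym (trans (cong (quotient {n}) (carry (+ suc j) (q * + n))) (quotient-residue q i<n)))
    where
    carry : ∀ a b → a + b + 1ℤ ≡ 1ℤ + a + b
    carry = solve-∀

  -- Both members of a swapped pair i + qn, i + 1 + qn lie in window q, because 1 ≤ i < n.
  s-preserving : ∀ {i} → 1 ≤ i → i < n → WindowPreserving (s {n} i)
  s-preserving {i} 1≤i i<n a with + n ∣? (a - + i) | + n ∣? (a - (+ i + 1ℤ))
  ... | yes p@(divides q eq) | _ =
    trans (cong (quotient {n}) (trans (swap-up i a p) (cong (_+ 1ℤ) a≡)))
      (trans (sym (quotient-step q 1≤i i<n)) (cong (quotient {n}) (sym a≡)))
    where
    solve-for : ∀ c i → c ≡ i + (c - i)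
    solve-for = solve-∀
    a≡ : a ≡ + i + q * + n
    a≡ = trans (solve-for a (+ i)) (cong (λ z → + i + z) eq)
  ... | no _  | yes p@(divides q eq) =
    trans (cong (quotient {n}) (trans (swap-down i a p) a-1≡))
      (trans (quotient-step q 1≤i i<n) (cong (quotient {n}) (trans (cong (_+ 1ℤ) (sym a-1≡)) (cancel a))))
    where
    solve-for : ∀ c i → c - 1ℤ ≡ i + (c - (i + 1ℤ))
    solve-for = solve-∀
    cancel : ∀ a → a - 1ℤ + 1ℤ ≡ a
    cancel = solve-∀
    a-1≡ : a - 1ℤ ≡ + i + q * + n
    a-1≡ = trans (solve-for a (+ i)) (cong (λ z → + i + z) eq)
  ... | no p  | no q  = cong (quotient {n}) (swap-fix i a p q)

  Wᴶ-preserving : ∀ {u : S̃ n} → u ∈ Wᴶ → WindowPreserving u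
  Wᴶ-preserving (gen (i , 1≤i , i<n , u≈s)) a = trans (cong (quotient {n}) (u≈s a)) (s-preserving 1≤i i<n a)
  Wᴶ-preserving unit                       a = refl
  Wᴶ-preserving (mul {f} {g} f∈ g∈)        a = trans (Wᴶ-preserving g∈ (f ⟨$⟩ a)) (Wᴶ-preserving f∈ a)
  Wᴶ-preserving (inv {f} f∈)               a =
    trans (sym (Wᴶ-preserving f∈ ((f ⁻¹) ⟨$⟩ a))) (cong (quotient {n}) (Inverse.strictlyInverseˡ (perm f) a))
  Wᴶ-preserving (resp f≈g f∈)              a = trans (cong (quotient {n}) (sym (f≈g a))) (Wᴶ-preserving f∈ a)

  -- Any minimal `y ≈ x ∙ u` is no longer than `x`, which itself lies in the coset, and this forces
  -- `u` to be trivial.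
  uniqueMinimal : ∀ {x : S̃ n} → WindowIncreasing (x ⁻¹) → IsUniqueMinimalIn (x ∙ᶜ Wᴶ) x
  uniqueMinimal {x} inc = (x∈ , minimal) , unique
    where
    x∈ : x ∈ x ∙ᶜ Wᴶ
    x∈ = e , unit , λ _ → refl
    minimal : ∀ y → y ∈ x ∙ᶜ Wᴶ → ℓ x ≤ ℓ y
    minimal y (u , u∈ , y≈xu) = subst (ℓ x ≤_) (sym (ℓ-cong {f = y} {g = x ∙ u} y≈xu))
      (ℓ-mono-≤ {f = x} {g = x ∙ u} (WindowIncreasing⇒⊑ {x = x} {u = u} inc (Wᴶ-preserving u∈)))
    unique : ∀ y → IsMinimalIn (x ∙ᶜ Wᴶ) y → y ≈ x
    unique y ((u , u∈ , y≈xu) , y-min) a = trans (y≈xu a)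
      (ℓ-coset-min⇒≈e {x = x} {u = u} inc (Wᴶ-preserving u∈)
        (subst (_≤ ℓ x) (ℓ-cong {f = y} {g = x ∙ u} y≈xu) (y-min x x∈)) (x ⟨$⟩ a))

-- Sums of displacements

-- Passes from the list sum defining the degree to a sum over `Fin m`, which can be reindexed by
-- permutations.
sum-range : ∀ (g : ℤ → ℤ) m → foldr _+_ 0ℤ (map g [1⋯ m ]) ≡ sum {m} (λ r → g (+ suc (toℕ r)))
sum-range g m = go id m
  where
  -- `upTo` is `applyUpTo id`; a general `h` is needed because the tail of the list replaces it by
  -- `h ∘ suc`.
  go : ∀ h m → foldr _+_ 0ℤ (map g (map (λ j → + suc j) (applyUpTo h m))) ≡ sum {m} (λ r → g (+ suc (h (toℕ r))))
  go h 0       = refl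
  go h (suc m) = cong (λ z → g (+ suc (h 0)) + z) (go (h ∘ suc) m)

sum-const : ∀ m z → sum {m} (λ _ → z) ≡ z * + m
sum-const 0       z = sym (ℤ.*-zeroʳ z)
sum-const (suc m) z = trans (cong (λ t → z + t) (sum-const m z)) (distrib z (+ m))
  where
  distrib : ∀ z m → z + z * m ≡ z * (1ℤ + m)
  distrib = solve-∀

sum-indicator : ∀ {m k} → k ≤ m → ∀ z → sum {m} (λ r → (if does (toℕ r ℕ.<? k) then 1ℤ else 0ℤ) * z) ≡ + k * z
sum-indicator {m}     {0}     _         z = sum-const m 0ℤ
sum-indicator {suc m} {suc k} (s≤s k≤m) z = trans (cong (λ t → 1ℤ * z + t) (sum-indicator k≤m z)) (distrib z (+ k))
  where
  distrib : ∀ z k → 1ℤ * z + k * z ≡ (1ℤ + k) * z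
  distrib = solve-∀

-- Equality of the unnormalised fractions is cross-multiplication, and normalisation respects it.
*-/-cancel : ∀ k n .{{_ : NonZero n}} → (k * + n) ℚ./ n ≡ k ℚ./ 1
*-/-cancel k (suc m) = ℚ.fromℚᵘ-cong {mkℚᵘ (k * + suc m) m} {mkℚᵘ k 0} (*≡* (ℤ.*-identityʳ (k * + suc m)))

-- The element x_w

module _ {n : ℕ} .{{_ : NonTrivial n}} (k : ℕ) (w : Permutation′ n) where

  private
    instance
      n-nonZero : NonZero n
      n-nonZero = nonTrivial⇒nonZero n

    x : S̃ n
    x = x[ k , w ]

    c : Fin n → ℤ
    c = τ-shift k

  x-spec : ∀ r → x ⟨$⟩ (+ suc (toℕ r)) ≡ + suc (toℕ (w ⟨$⟩ˡ r)) + c (w ⟨$⟩ˡ r) * + n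
  x-spec r = trans (cong (τ k ⟨$⟩_) ext⁻¹) (windowed-spec (↔-refl (Fin n)) c (w ⟨$⟩ˡ r))
    where
    ext⁻¹ : (extend w ⁻¹) ⟨$⟩ (+ suc (toℕ r)) ≡ + suc (toℕ (w ⟨$⟩ˡ r))
    ext⁻¹ = trans
      (cong ((extend w ⁻¹) ⟨$⟩_) (sym (trans (extend-spec w (w ⟨$⟩ˡ r)) (cong (λ z → + suc (toℕ z)) (inverseʳ w)))))
      (Inverse.strictlyInverseʳ (perm (extend w)) (+ suc (toℕ (w ⟨$⟩ˡ r))))

  -- τ⁻¹ moves the residues of the first block down one window, then `w` acts inside the window. For
  -- q = 0 the values are w(i) - n for i ≤ k and w(i) for i > k.
  x⁻¹-spec : ∀ q r → (x ⁻¹) ⟨$⟩ fromWindow (q , r) ≡ fromWindow (q - c r , w ⟨$⟩ʳ r)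
  x⁻¹-spec q r = trans (cong (extend w ⟨$⟩_) τ⁻¹)
    (trans (shift (extend w) (+ suc (toℕ r)) (q - c r)) (cong (_+ (q - c r) * + n) (extend-spec w r)))
    where
    cancel : ∀ R c q m → R + c * m + (q - c) * m ≡ R + q * m
    cancel = solve-∀
    τ⁻¹ : (τ k ⁻¹) ⟨$⟩ fromWindow (q , r) ≡ fromWindow (q - c r , r)
    τ⁻¹ = trans
      (cong ((τ k ⁻¹) ⟨$⟩_) (sym (trans (shift (τ k) (+ suc (toℕ r)) (q - c r))
        (trans (cong (_+ (q - c r) * + n) (windowed-spec (↔-refl (Fin n)) c r)) (cancel (+ suc (toℕ r)) (c r) q (+ n))))))
      (Inverse.strictlyInverseʳ (perm (τ k)) (fromWindow (q - c r , r)))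

  -- The degree of x_w and the translation case.

  module _ (k≤n : k ≤ n) where

    x-displacement : foldr _+_ 0ℤ (map (λ i → x ⟨$⟩ i - i) [1⋯ n ]) ≡ + k * + n
    x-displacement = begin
      foldr _+_ 0ℤ (map (λ i → x ⟨$⟩ i - i) [1⋯ n ])
        ≡⟨ sum-range (λ i → x ⟨$⟩ i - i) n ⟩
      sum {n} (λ r → x ⟨$⟩ (+ suc (toℕ r)) - + suc (toℕ r))
        ≡⟨ sum-cong-≗ {n} (λ r → cong (_- + suc (toℕ r)) (x-spec r)) ⟩
      sum {n} (λ r → h (w ⟨$⟩ˡ r) - + suc (toℕ r))
        ≡⟨ ∑-distrib-+ {n} (λ r → h (w ⟨$⟩ˡ r)) (λ r → - (+ suc (toℕ r))) ⟩
      sum {n} (λ r → h (w ⟨$⟩ˡ r)) + sum {n} (λ r → - (+ suc (toℕ r)))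
        -- Reindexing by w⁻¹ removes the permutation; only the k shifts by n then survive the
        -- subtraction.
        ≡⟨ cong (_+ sum {n} (λ r → - (+ suc (toℕ r)))) (sum-permute h (flip w)) ⟨
      sum {n} h + sum {n} (λ r → - (+ suc (toℕ r)))
        ≡⟨ ∑-distrib-+ {n} h (λ r → - (+ suc (toℕ r))) ⟨
      sum {n} (λ r → h r - + suc (toℕ r))
        ≡⟨ sum-cong-≗ {n} (λ r → cancel (+ suc (toℕ r)) (c r * + n)) ⟩
      sum {n} (λ r → c r * + n)
        ≡⟨ sum-indicator k≤n (+ n) ⟩
      + k * + n ∎
      where
      open ≡-Reasoning
      h : Fin n → ℤ
      h r = + suc (toℕ r) + c r * + n
      cancel : ∀ a b → a + b - a ≡ b
      cancel = solve-∀

    x∈S̃⁽k⁾ : x ∈ S̃⁽ k ⁾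
    x∈S̃⁽k⁾ = trans (cong (ℚ._/ n) x-displacement) (*-/-cancel (+ k) n)

    x-increasing⇒≈Λ^k : Increasing (x ⟨$⟩_) → (Λ ^ k) ⁻¹ ∙ x ≈ e
    x-increasing⇒≈Λ^k inc a = trans (x≈Λ^k (((Λ ^ k) ⁻¹) ⟨$⟩ a)) (Inverse.strictlyInverseˡ (perm (Λ {n} ^ k)) a)
      where
      transl : ∀ a → x ⟨$⟩ a ≡ x ⟨$⟩ 0ℤ + a
      transl = increasing⇒translation x inc
      cancel : ∀ a b → a + b - b ≡ a
      cancel = solve-∀
      x0*n≡k*n : x ⟨$⟩ 0ℤ * + n ≡ + k * + n
      -- As a translation, `x` displaces every integer by x(0), so its total displacement over a
      -- window is n x(0).
      x0*n≡k*n = begin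
        x ⟨$⟩ 0ℤ * + n
          ≡⟨ sum-const n (x ⟨$⟩ 0ℤ) ⟨
        sum {n} (λ _ → x ⟨$⟩ 0ℤ)
          ≡⟨ sum-cong-≗ {n} (λ r → trans (cong (_- + suc (toℕ r)) (transl (+ suc (toℕ r)))) (cancel (x ⟨$⟩ 0ℤ) (+ suc (toℕ r)))) ⟨
        sum {n} (λ r → x ⟨$⟩ (+ suc (toℕ r)) - + suc (toℕ r))
          ≡⟨ sum-range (λ i → x ⟨$⟩ i - i) n ⟨
        foldr _+_ 0ℤ (map (λ i → x ⟨$⟩ i - i) [1⋯ n ])
          ≡⟨ x-displacement ⟩
        + k * + n ∎
        where open ≡-Reasoning
      x≈Λ^k : x ≈ Λ ^ k
      x≈Λ^k a = trans (transl a)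
        (trans (cong (_+ a) (ℤ.*-cancelʳ-≡ (x ⟨$⟩ 0ℤ) (+ k) (+ n) x0*n≡k*n))
          (trans (ℤ.+-comm (+ k) a) (sym (Λ^k-spec k a))))

  -- Ascents and the descent of a Grassmannian x_w.

  module _ (grass : IsGrassmannian k w) where
    open IsGrassmannian grass

    private
      c-≤k : ∀ {r} → toℕ r < k → c r ≡ 1ℤ
      c-≤k {r} r<k rewrite dec-true (toℕ r ℕ.<? k) r<k = refl

      c->k : ∀ {r} → k ≤ toℕ r → c r ≡ 0ℤ
      c->k {r} k≤r rewrite dec-false (toℕ r ℕ.<? k) (ℕ.≤⇒≯ k≤r) = refl

      -- Two residues in the same block get the same window shift, so the Grassmannian condition
      -- orders them. If they straddle the blocks, the smaller one lands one window earlier,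
      -- whatever `w` does.
      row-increasing : ∀ q {r r′} → r Fin.< r′ → fromWindow (q - c r , w ⟨$⟩ʳ r) ℤ.< fromWindow (q - c r′ , w ⟨$⟩ʳ r′)
      row-increasing q {r} {r′} r<r′ with ℕ.<-≤-connex (toℕ r′) k | ℕ.<-≤-connex (toℕ r) k
      ... | inj₁ r′<k | _
        rewrite c-≤k {r} (ℕ.<-trans r<r′ r′<k) | c-≤k {r′} r′<k = fromWindow-monoʳ-< (q - 1ℤ) (increasing-≤k r r′ r<r′ r′<k)
      ... | inj₂ k≤r′ | inj₂ k≤r
        rewrite c->k {r} k≤r | c->k {r′} k≤r′ = fromWindow-monoʳ-< (q - 0ℤ) (increasing->k r r′ r<r′ k≤r)
      ... | inj₂ k≤r′ | inj₁ r<k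
        rewrite c-≤k {r} r<k | c->k {r′} k≤r′ = fromWindow-monoˡ-< (w ⟨$⟩ʳ r) (w ⟨$⟩ʳ r′) (ℤ.+-monoʳ-< q ℤ.-<+)

    x⁻¹-windowIncreasing : WindowIncreasing (x ⁻¹)
    x⁻¹-windowIncreasing {a} {b} qa≡qb a<b = subst₂ (λ y z → (x ⁻¹) ⟨$⟩ y ℤ.< (x ⁻¹) ⟨$⟩ z) (fromWindow∘toWindow {n} a) b≡
      (subst₂ ℤ._<_ (sym (x⁻¹-spec q r)) (sym (x⁻¹-spec q r′))
        (row-increasing q (fromWindow-cancelʳ-< q r r′ (subst₂ ℤ._<_ (sym (fromWindow∘toWindow {n} a)) (sym b≡) a<b))))
      where
      q : ℤ
      q = quotient {n} a
      r r′ : Fin n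
      r = proj₂ (toWindow {n} a)
      r′ = proj₂ (toWindow {n} b)
      b≡ : fromWindow (q , r′) ≡ b
      b≡ = trans (cong (λ z → fromWindow (z , r′)) qa≡qb) (fromWindow∘toWindow {n} b)

    x-ascent : ∀ {i} → 1 ≤ i → i < n → ℓ x < ℓ (x ∙ s i)
    x-ascent {i} 1≤i i<n = ascent x i (x⁻¹-windowIncreasing
      (subst (λ z → quotient {n} z ≡ quotient {n} (z + 1ℤ)) (ℤ.+-identityʳ (+ i)) (quotient-step 0ℤ 1≤i i<n))
      (i<i+1 (+ i)))

    x⁻¹-increasing : (x ⁻¹) ⟨$⟩ 0ℤ ℤ.< (x ⁻¹) ⟨$⟩ 1ℤ → Increasing ((x ⁻¹) ⟨$⟩_)
    x⁻¹-increasing 0<1 = stepwise⇒increasing ((x ⁻¹) ⟨$⟩_)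
      λ a → subst (λ a → (x ⁻¹) ⟨$⟩ a ℤ.< (x ⁻¹) ⟨$⟩ (a + 1ℤ)) (fromWindow∘toWindow {n} a)
              (step (proj₁ (toWindow {n} a)) (proj₂ (toWindow {n} a)))
      where
      last : ∀ q m → 0ℤ + (1ℤ + q) * m ≡ m + q * m
      last = solve-∀
      first : ∀ q m → 1ℤ + (1ℤ + q) * m ≡ m + q * m + 1ℤ
      first = solve-∀
      step : ∀ q (r : Fin n) → (x ⁻¹) ⟨$⟩ fromWindow (q , r) ℤ.< (x ⁻¹) ⟨$⟩ (fromWindow (q , r) + 1ℤ)
      step q r with ℕ.m≤n⇒m<n∨m≡n (toℕ<n r)
      ... | inj₁ r+1<n = x⁻¹-windowIncreasing (quotient-step q (s≤s z≤n) r+1<n) (i<i+1 (fromWindow (q , r)))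
      -- The step leaves window q: it is the step from 0 to 1 translated by (1 + q)n.
      ... | inj₂ r+1≡n = subst (λ R → (x ⁻¹) ⟨$⟩ (+ R + q * + n) ℤ.< (x ⁻¹) ⟨$⟩ (+ R + q * + n + 1ℤ)) (sym r+1≡n)
        (subst₂ ℤ._<_
          (trans (sym (shift (x ⁻¹) 0ℤ (1ℤ + q))) (cong ((x ⁻¹) ⟨$⟩_) (last q (+ n))))
          (trans (sym (shift (x ⁻¹) 1ℤ (1ℤ + q))) (cong ((x ⁻¹) ⟨$⟩_) (first q (+ n))))
          (ℤ.+-monoˡ-< ((1ℤ + q) * + n) 0<1))

    x⁻¹-drop : k ≤ n → ¬ ((Λ ^ k) ⁻¹ ∙ x ≈ e) → (x ⁻¹) ⟨$⟩ 1ℤ ℤ.< (x ⁻¹) ⟨$⟩ 0ℤ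
    x⁻¹-drop k≤n x≉e = ℤ.≤∧≢⇒<
      (ℤ.≮⇒≥ λ 0<1 → x≉e (x-increasing⇒≈Λ^k k≤n (inverse-increasing x (x⁻¹-increasing 0<1))))
      (λ eq → 1≢0 (⟨$⟩-injective (x ⁻¹) eq))
      where
      1≢0 : 1ℤ ≢ 0ℤ
      1≢0 ()

    x-descent-0 : k ≤ n → ¬ ((Λ ^ k) ⁻¹ ∙ x ≈ e) → ℓ (x ∙ s 0) < ℓ x
    x-descent-0 k≤n x≉e = descent x 0 (x⁻¹-drop k≤n x≉e)

lemma3p8 : (n : ℕ) .{{_ : NonTrivial n}} (k : ℕ) → k ≤ n →
    (w : Permutation′ n) → IsGrassmannian k w →
    ¬ ((Λ ^ k) ⁻¹ ∙ x[ k , w ] ≈ e) →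
    (rightDescents x[ k , w ] ≐ (_≈ s 0))
    × x[ k , w ] ∈ S̃⁽ k ⁾ᴶ
    × IsUniqueMinimalIn (x[ k , w ] ∙ᶜ Wᴶ) x[ k , w ]
lemma3p8 n k k≤n w grass x≉e =
    ((λ {y} → descents⊆ {y}) , (λ {y} y≈s₀ → 0 , ℕ.<⇒≤ (nonTrivial⇒n>1 n) , y≈s₀ , x-descent-0 k w grass k≤n x≉e))
  , (x∈S̃⁽k⁾ k w k≤n , J-ascents)
  , uniqueMinimal {x = x} (x⁻¹-windowIncreasing k w grass)
  where
  instance
    n-nonZero : NonZero n
    n-nonZero = nonTrivial⇒nonZero n
  x : S̃ n
  x = x[ k , w ]
  descents⊆ : ∀ {y} → y ∈ rightDescents x → y ≈ s 0
  descents⊆ (0     , _   , y≈s , _)    = y≈s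
  -- A positive index below n is an ascent, so it cannot also be a descent.
  descents⊆ (suc i , i<n , _   , desc) = ⊥-elim (ℕ.<-asym desc (x-ascent k w grass (s≤s z≤n) i<n))
  J-ascents : ∀ t → t ∈ J → ℓ x < ℓ (x ∙ t)
  J-ascents t (i , 1≤i , i<n , t≈s) = subst (ℓ x <_)
    (ℓ-cong {f = x ∙ s i} {g = x ∙ t} (λ a → sym (t≈s (x ⟨$⟩ a))))
    (x-ascent k w grass 1≤i i<n)
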